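{- Let $f$ be a formula. There exists a derivation $\emptyset\parallel f\Longrightarrow^*\mathtt{fail}$ in the classical DPLL transition system if and only if $f$ is unsatisfiable.
   Context: Fix a finite set $P$ of atoms. A literal is an atom $p\in P$ or its negation $\neg p$, with $\neg\neg p=p$. A clause is a finite list of literals, read as their disjunction; a formula (CNF) is a finite list of clauses, read as their conjunction. A partial assignment is an arbitrary finite list of literals, each annotated either as a decision literal (written $l^d$) or as a propagated literal (written $l$). New literals are appended on the right, $mn$ denotes concatenation, and $\emptyset$ is the empty list. Evaluation takes values in $\{T,F,U\}$ and ignores annotations; the rightmost occurrence of an atom takes precedence: $[\![l]\!]_m=T$ if the rightmost occurrence in $m$ of the atom of $l$ is as $l$, $F$ if it is as $\neg l$, and $U$ if the atom does not occur in $m$. For a clause $c$: $[\![c]\!]_m=T$ if some literal of $c$ evaluates to $T$, $F$ if all literals of $c$ evaluate to $F$, else $U$. For a formula $f$: $[\![f]\!]_m=T$ if all clauses evaluate to $T$, $F$ if some clause evaluates to $F$, else $U$. "True/false/undefined in $m$" means value $T/F/U$. $m$ satisfies $f$ (is a model of $f$) if $[\![f]\!]_m=T$; $f$ is unsatisfiable if it has no model. A state is either the distinguished state $\mathtt{fail}$ or a pair $m\parallel f$ of a partial assignment and a formula. The classical DPLL system is the relation $\Longrightarrow$ on states given by the rules (order within clauses and formulas being irrelevant for reading $c\lor l$, $f\land c$): UnitPropagate: $m\parallel f\land(c\lor l)\Longrightarrow m\,l\parallel f\land(c\lor l)$ if $c$ is false in $m$ and $l$ is undefined in $m$. Decide: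 $m\parallel f\Longrightarrow m\,l^d\parallel f$ if $l$ or $\neg l$ occurs in a clause of $f$ and $l$ is undefined in $m$. Fail: $m\parallel f\land c\Longrightarrow\mathtt{fail}$ if $c$ is false in $m$ and $m$ contains no decision literals. Backtrack: $m\,l^d\,n\parallel f\land c\Longrightarrow m\,\neg l\parallel f\land c$ if $c$ is false in $m\,l^d\,n$ and $n$ contains no decision literals (the new $\neg l$ is propagated). Pure: $m\parallel f\Longrightarrow m\,l\parallel f$ if $l$ occurs in a clause of $f$, $\neg l$ occurs in no clause of $f$, and $l$ is undefined in $m$. $\Longrightarrow^*$ is the reflexive-transitive closure; sequences of transitions under it are derivations. -}

module Defs where

open import Data.Bool.Base using (if_then_else_)
open import Data.Fin.Base using (Fin)
open import Data.Fin.Properties using (inj⇒≟)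
open import Data.List.Base using (List; []; _∷_; _++_; _∷ʳ_)
open import Data.List.Membership.Propositional using (_∈_; _∉_)
open import Data.List.Relation.Binary.Permutation.Propositional using (_↭_)
open import Data.List.Relation.Unary.All using (all?)
open import Data.List.Relation.Unary.Any using (Any; any?)
open import Data.Nat.Base using (ℕ)
open import Data.Product.Base using (∃-syntax)
open import Data.Sum.Base using (_⊎_)
open import Function.Bundles using (_↔_)
open import Function.Properties.Inverse using (↔⇒↣)
open import Relation.Binary.Construct.Closure.ReflexiveTransitive using (Star)
open import Relation.Binary.Definitions using (DecidableEquality)
open import Relation.Binary.PropositionalEquality using (_≡_; refl; cong)
open import Relation.Nullary using (¬_; yes; no; does)
open import Relation.Nullary.Decidable using (map′)

data Value : Set where
  T F U : Value

infix 4 _≟ᵛ_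

_≟ᵛ_ : DecidableEquality Value
T ≟ᵛ T = yes refl
T ≟ᵛ F = no λ ()
T ≟ᵛ U = no λ ()
F ≟ᵛ T = no λ ()
F ≟ᵛ F = yes refl
F ≟ᵛ U = no λ ()
U ≟ᵛ T = no λ ()
U ≟ᵛ F = no λ ()
U ≟ᵛ U = yes refl

infixr 5 _orElse_

_orElse_ : Value → Value → Value
T orElse _ = T
F orElse _ = F
U orElse v = v

module DPLL {n : ℕ} {P : Set} (finite : P ↔ Fin n) where

  infix 4 _≟_ _≟ˡ_

  _≟_ : DecidableEquality P
  _≟_ = inj⇒≟ (↔⇒↣ finite)

  data Literal : Set where
    pos neg : P → Literal

  infix 10 ∼_

  ∼_ : Literal → Literal
  ∼ pos p = neg p
  ∼ neg p = pos p

  _≟ˡ_ : DecidableEquality Literal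
  pos p ≟ˡ pos q = map′ (cong pos) (λ { refl → refl }) (p ≟ q)
  pos p ≟ˡ neg q = no λ ()
  neg p ≟ˡ pos q = no λ ()
  neg p ≟ˡ neg q = map′ (cong neg) (λ { refl → refl }) (p ≟ q)

  Clause : Set
  Clause = List Literal

  Formula : Set
  Formula = List Clause

  infix 9 _ᵈ _ᵖ

  data AnnotatedLiteral : Set where
    _ᵈ : Literal → AnnotatedLiteral   -- decision literal
    _ᵖ : Literal → AnnotatedLiteral   -- propagated literal

  literal : AnnotatedLiteral → Literal
  literal (l ᵈ) = l
  literal (l ᵖ) = l

  -- No consistency is required: an atom may occur repeatedly, with either sign.
  PartialAssignment : Set
  PartialAssignment = List AnnotatedLiteral

  -- The tail is consulted first, so the rightmost occurrence of an atom wins.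
  ⟦_⟧ˡ : Literal → PartialAssignment → Value
  ⟦ l ⟧ˡ []      = U
  ⟦ l ⟧ˡ (a ∷ m) = ⟦ l ⟧ˡ m orElse
    (if does (literal a ≟ˡ l)   then T else
     if does (literal a ≟ˡ ∼ l) then F else U)

  ⟦_⟧ᶜ : Clause → PartialAssignment → Value
  ⟦ c ⟧ᶜ m =
    if does (any? (λ l → ⟦ l ⟧ˡ m ≟ᵛ T) c) then T else
    if does (all? (λ l → ⟦ l ⟧ˡ m ≟ᵛ F) c) then F else U

  ⟦_⟧ : Formula → PartialAssignment → Value
  ⟦ f ⟧ m =
    if does (all? (λ c → ⟦ c ⟧ᶜ m ≟ᵛ T) f) then T else
    if does (any? (λ c → ⟦ c ⟧ᶜ m ≟ᵛ F) f) then F else U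

  infix 4 _⊨_ _OccursIn_

  _⊨_ : PartialAssignment → Formula → Set
  m ⊨ f = ⟦ f ⟧ m ≡ T

  Unsatisfiable : Formula → Set
  Unsatisfiable f = ¬ (∃[ m ] m ⊨ f)

  _OccursIn_ : Literal → Formula → Set
  l OccursIn f = Any (l ∈_) f

  NoDecisions : PartialAssignment → Set
  NoDecisions m = ∀ l → l ᵈ ∉ m

  infix 4 _∥_

  data State : Set where
    fail : State
    _∥_  : PartialAssignment → Formula → State

  infix 3 _⟹_ _⟹*_

  -- Order is irrelevant when a rule reads a formula as f ∧ c or a clause as
  -- c ∨ l: the former is membership of c, the latter a permutation of c ∷ʳ l.
  -- The formula itself is never changed by a transition.
  data _⟹_ : State → State → Set where
    unitPropagate : ∀ {m f c c′ l} →
      c′ ∈ f → c′ ↭ c ∷ʳ l →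
      ⟦ c ⟧ᶜ m ≡ F → ⟦ l ⟧ˡ m ≡ U →
      m ∥ f ⟹ m ∷ʳ l ᵖ ∥ f
    decide : ∀ {m f l} →
      l OccursIn f ⊎ ∼ l OccursIn f → ⟦ l ⟧ˡ m ≡ U →
      m ∥ f ⟹ m ∷ʳ l ᵈ ∥ f
    failure : ∀ {m f c} →
      c ∈ f → ⟦ c ⟧ᶜ m ≡ F → NoDecisions m →
      m ∥ f ⟹ fail
    backtrack : ∀ {m l n f c} →
      c ∈ f → ⟦ c ⟧ᶜ (m ++ l ᵈ ∷ n) ≡ F → NoDecisions n →
      m ++ l ᵈ ∷ n ∥ f ⟹ m ∷ʳ (∼ l) ᵖ ∥ f
    pure : ∀ {m f l} →
      l OccursIn f → ¬ (∼ l OccursIn f) → ⟦ l ⟧ˡ m ≡ U →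
      m ∥ f ⟹ m ∷ʳ l ᵖ ∥ f

  _⟹*_ : State → State → Set
  _⟹*_ = Star _⟹_

{-# OPTIONS --safe #-}

-- Refutation soundness: along a derivation, adding a propagated literal to the
-- assignment never destroys the satisfiability of f by a total valuation that
-- agrees with the assignment so far.  (Entailment would be too strong: Pure may
-- add a literal that is not entailed, but a model can be modified to satisfy it.)
-- Hence a conflict without decisions refutes f.
--
-- Completeness: Decide and Backtrack suffice.  By recursion on the literals left
-- to assign, every m leads to a conflict m n with n free of decisions: decide l,
-- reach a conflict, backtrack to m ¬l, and reach a conflict again.

module Submission where

open import Defs
open import Data.Bool.Base using (Bool; true; false; if_then_else_)
open import Data.Empty using (⊥-elim)
open import Data.Fin.Base using (Fin)
open import Data.List.Base using (List; []; _∷_; _++_; _∷ʳ_; map; concat; reverse)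
open import Data.List.Membership.Propositional using (_∈_; lose; find)
open import Data.List.Membership.Propositional.Properties
  using (∈-concat⁺; ∈-concat⁻; ∈-map⁺; ∈-map⁻; ∈-++⁺ˡ; ∈-++⁺ʳ)
open import Data.List.Properties using (map-++; ++-assoc; ++-identityʳ; reverse-++; unfold-reverse)
open import Data.List.Relation.Binary.Permutation.Propositional.Properties using (Any-resp-↭)
open import Data.List.Relation.Unary.All as All using (All; []; _∷_; all?)
open import Data.List.Relation.Unary.All.Properties using (¬All⇒Any¬; ¬Any⇒All¬)
open import Data.List.Relation.Unary.Any as Any using (Any; here; there; any?)
open import Data.List.Relation.Unary.Any.Properties using (++⁻; singleton⁻; reverse⁺; reverse⁻)
open import Data.Nat.Base using (ℕ)
open import Data.Product.Base using (_×_; _,_; ∃-syntax)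
open import Data.Sum.Base as Sum using (_⊎_; inj₁; inj₂)
open import Function.Base using (_∘_; case_of_)
open import Function.Bundles using (_↔_; _⇔_; mk⇔)
open import Relation.Binary.Construct.Closure.ReflexiveTransitive using (ε; _◅_; _◅◅_)
open import Relation.Binary.PropositionalEquality
  using (_≡_; _≢_; refl; sym; trans; cong; subst)
open import Relation.Nullary using (¬_; Dec; yes; no; does)
open import Relation.Nullary.Decidable using (dec-true)

module _ {n : ℕ} {P : Set} (finite : P ↔ Fin n) where
  open DPLL finite

  -- Values of literals, clauses and formulas

  true⇒∈ : ∀ l m → ⟦ l ⟧ˡ m ≡ T → l ∈ map literal m
  true⇒∈ l (a ∷ m) eq with ⟦ l ⟧ˡ m in e | literal a ≟ˡ l | literal a ≟ˡ ∼ l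
  ... | T | _        | _     = there (true⇒∈ l m e)
  ... | U | yes refl | _     = here refl
  ... | U | no _     | yes _ = case eq of λ ()
  ... | U | no _     | no _  = case eq of λ ()

  false⇒∈ : ∀ l m → ⟦ l ⟧ˡ m ≡ F → ∼ l ∈ map literal m
  false⇒∈ l (a ∷ m) eq with ⟦ l ⟧ˡ m in e | literal a ≟ˡ l | literal a ≟ˡ ∼ l
  ... | F | _     | _     = there (false⇒∈ l m e)
  ... | U | yes _ | _     = case eq of λ ()
  ... | U | no _  | yes p = here (sym p)
  ... | U | no _  | no _  = case eq of λ ()

  undefined⇒∉ : ∀ l m → ⟦ l ⟧ˡ m ≡ U → ¬ (l ∈ map literal m ⊎ ∼ l ∈ map literal m)
  undefined⇒∉ l []      _  (inj₁ ())
  undefined⇒∉ l []      _  (inj₂ ())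
  undefined⇒∉ l (a ∷ m) eq occ with ⟦ l ⟧ˡ m in e | literal a ≟ˡ l | literal a ≟ˡ ∼ l
  undefined⇒∉ l (a ∷ m) () _                | U | yes _ | _
  undefined⇒∉ l (a ∷ m) () _                | U | no _  | yes _
  undefined⇒∉ l (a ∷ m) _ (inj₁ (here p))   | U | no ¬p | no _ = ¬p (sym p)
  undefined⇒∉ l (a ∷ m) _ (inj₂ (here p))   | U | no _  | no ¬p = ¬p (sym p)
  undefined⇒∉ l (a ∷ m) _ (inj₁ (there i))  | U | no _  | no _ = undefined⇒∉ l m e (inj₁ i)
  undefined⇒∉ l (a ∷ m) _ (inj₂ (there i))  | U | no _  | no _ = undefined⇒∉ l m e (inj₂ i)

  false-clause⇒All : ∀ c m → ⟦ c ⟧ᶜ m ≡ F → All (λ l → ⟦ l ⟧ˡ m ≡ F) c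
  false-clause⇒All c m eq
    with any? (λ l → ⟦ l ⟧ˡ m ≟ᵛ T) c | all? (λ l → ⟦ l ⟧ˡ m ≟ᵛ F) c
  ... | yes _ | _      = case eq of λ ()
  ... | no _  | yes fs = fs
  ... | no _  | no _   = case eq of λ ()

  true-clause⇒Any : ∀ c m → ⟦ c ⟧ᶜ m ≡ T → Any (λ l → ⟦ l ⟧ˡ m ≡ T) c
  true-clause⇒Any c m eq
    with any? (λ l → ⟦ l ⟧ˡ m ≟ᵛ T) c | all? (λ l → ⟦ l ⟧ˡ m ≟ᵛ F) c
  ... | yes t | _     = t
  ... | no _  | yes _ = case eq of λ ()
  ... | no _  | no _  = case eq of λ ()

  ⊨⇒All : ∀ f m → m ⊨ f → All (λ c → ⟦ c ⟧ᶜ m ≡ T) f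
  ⊨⇒All f m eq
    with all? (λ c → ⟦ c ⟧ᶜ m ≟ᵛ T) f | any? (λ c → ⟦ c ⟧ᶜ m ≟ᵛ F) f
  ... | yes ts | _     = ts
  ... | no _   | yes _ = case eq of λ ()
  ... | no _   | no _  = case eq of λ ()

  All⇒⊨ : ∀ f m → All (λ c → ⟦ c ⟧ᶜ m ≡ T) f → m ⊨ f
  All⇒⊨ f m ts with all? (λ c → ⟦ c ⟧ᶜ m ≟ᵛ T) f
  ... | yes _ = refl
  ... | no ¬ts = ⊥-elim (¬ts ts)

  -- Total valuations

  -- Totality gives the case split that Backtrack needs, and a single atom can be overwritten, as
  -- Pure needs.
  Valuation : Set
  Valuation = P → Bool

  infix 4 _⊩_ _⊩ᶠ_

  _⊩_ : Valuation → Literal → Set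
  v ⊩ pos p = v p ≡ true
  v ⊩ neg p = v p ≡ false

  _⊩ᶠ_ : Valuation → Formula → Set
  v ⊩ᶠ f = All (Any (v ⊩_)) f

  ⊩-total : ∀ v l → v ⊩ l ⊎ v ⊩ ∼ l
  ⊩-total v (pos p) with v p
  ... | true  = inj₁ refl
  ... | false = inj₂ refl
  ⊩-total v (neg p) with v p
  ... | true  = inj₂ refl
  ... | false = inj₁ refl

  ⊩-consistent : ∀ {v} l → v ⊩ l → ¬ v ⊩ ∼ l
  ⊩-consistent (pos p) t f = case trans (sym t) f of λ ()
  ⊩-consistent (neg p) f t = case trans (sym t) f of λ ()

  _[_≔_] : Valuation → P → Bool → Valuation
  (v [ p ≔ b ]) q = if does (q ≟ p) then b else v q

  assign : Valuation → Literal → Valuation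
  assign v (pos p) = v [ p ≔ true ]
  assign v (neg p) = v [ p ≔ false ]

  update-at : ∀ v p b → (v [ p ≔ b ]) p ≡ b
  update-at v p b = cong (λ t → if t then b else v p) (dec-true (p ≟ p) refl)

  update-preserves : ∀ v p b q → (q ≡ p → v q ≡ b) → (v [ p ≔ b ]) q ≡ v q
  update-preserves v p b q h = preserves (q ≟ p)
    where
    preserves : (d : Dec (q ≡ p)) → (if does d then b else v q) ≡ v q
    preserves (yes q≡p) = sym (h q≡p)
    preserves (no _)    = refl

  assign-⊩ : ∀ v l → assign v l ⊩ l
  assign-⊩ v (pos p) = update-at v p true
  assign-⊩ v (neg p) = update-at v p false

  -- For equal signs, coinciding atoms mean that the update changes nothing; for opposite signs,
  -- coinciding atoms would give `k ≡ ∼ l`.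
  assign-preserves : ∀ v l k → k ≢ ∼ l → v ⊩ k → assign v l ⊩ k
  assign-preserves v (pos p) (pos q) k≢ h =
    trans (update-preserves v p true q λ _ → h) h
  assign-preserves v (pos p) (neg q) k≢ h =
    trans (update-preserves v p true q (⊥-elim ∘ k≢ ∘ cong neg)) h
  assign-preserves v (neg p) (pos q) k≢ h =
    trans (update-preserves v p false q (⊥-elim ∘ k≢ ∘ cong pos)) h
  assign-preserves v (neg p) (neg q) k≢ h =
    trans (update-preserves v p false q λ _ → h) h

  -- Undefined atoms default to false. This is harmless: only literals already true in `m` are
  -- carried over.
  induced : PartialAssignment → Valuation
  induced m p = does (⟦ pos p ⟧ˡ m ≟ᵛ T)

  negate : Value → Value
  negate T = F
  negate F = T
  negate U = U

  -- Needed because `induced` inspects positive literals only. The same occurrence decides both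
  -- values, and it cannot equal both literals.
  neg-value : ∀ p m → ⟦ neg p ⟧ˡ m ≡ negate (⟦ pos p ⟧ˡ m)
  neg-value p [] = refl
  neg-value p (a ∷ m) rewrite neg-value p m with ⟦ pos p ⟧ˡ m
  ... | T = refl
  ... | F = refl
  ... | U with literal a ≟ˡ pos p | literal a ≟ˡ neg p
  ...   | yes a≡p | yes a≡¬p = case trans (sym a≡p) a≡¬p of λ ()
  ...   | yes _   | no _     = refl
  ...   | no _    | yes _    = refl
  ...   | no _    | no _     = refl

  induced-⊩ : ∀ l m → ⟦ l ⟧ˡ m ≡ T → induced m ⊩ l
  induced-⊩ (pos p) m eq rewrite eq = refl
  induced-⊩ (neg p) m eq with ⟦ pos p ⟧ˡ m | neg-value p m
  ... | T | eq′ = case trans (sym eq) eq′ of λ ()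
  ... | F | _   = refl
  ... | U | _   = refl

  ⊨⇒⊩ᶠ : ∀ f m → m ⊨ f → induced m ⊩ᶠ f
  ⊨⇒⊩ᶠ f m m⊨f =
    All.map (λ {c} t → Any.map (λ {l} → induced-⊩ l m) (true-clause⇒Any c m t)) (⊨⇒All f m m⊨f)

  -- Refutation soundness

  -- Every entry counts, not only the rightmost one of its atom, so a list with complementary
  -- literals agrees with no valuation.
  Agrees : Valuation → PartialAssignment → Set
  Agrees v = All (λ a → v ⊩ literal a)

  Satisfiable : Formula → PartialAssignment → Set
  Satisfiable f m = ∃[ v ] v ⊩ᶠ f × Agrees v m

  -- The assignment is stored newest literal first, i.e. reversed.
  data Justified (f : Formula) : PartialAssignment → Set where
    []         : Justified f []
    decision   : ∀ {l m} → Justified f m → Justified f (l ᵈ ∷ m)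
    propagated : ∀ {l m} → (Satisfiable f m → Satisfiable f (l ᵖ ∷ m)) →
                 Justified f m → Justified f (l ᵖ ∷ m)

  justified-++⁻ʳ : ∀ {f} n {m} → Justified f (n ++ m) → Justified f m
  justified-++⁻ʳ []      j                = j
  justified-++⁻ʳ (_ ∷ n) (decision j)     = justified-++⁻ʳ n j
  justified-++⁻ʳ (_ ∷ n) (propagated _ j) = justified-++⁻ʳ n j

  -- All of `n` is propagated, so its justifications compose from the oldest literal to the newest.
  -- The valuation may change on the way.
  satisfiable-++ : ∀ {f} n {m} → NoDecisions n → Justified f (n ++ m) →
                   Satisfiable f m → Satisfiable f (n ++ m)
  satisfiable-++ []      _  _                sat = sat
  satisfiable-++ (_ ∷ n) nd (decision _)     sat = ⊥-elim (nd _ (here refl))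
  satisfiable-++ (_ ∷ n) nd (propagated s j) sat =
    s (satisfiable-++ n (λ l → nd l ∘ there) j sat)

  agrees-false : ∀ {v l} m → Agrees v (reverse m) → ⟦ l ⟧ˡ m ≡ F → ¬ v ⊩ l
  agrees-false {l = l} m ag eq v⊩l with ∈-map⁻ literal (false⇒∈ l m eq)
  ... | a , a∈m , ∼l≡a =
    ⊩-consistent l v⊩l (subst (_ ⊩_) (sym ∼l≡a) (All.lookup ag (reverse⁺ a∈m)))

  agrees-false-clause : ∀ {v} c m → Agrees v (reverse m) → ⟦ c ⟧ᶜ m ≡ F → ¬ Any (v ⊩_) c
  agrees-false-clause c m ag eq t with find t
  ... | l , l∈c , v⊩l = agrees-false m ag (All.lookup (false-clause⇒All c m eq) l∈c) v⊩l

  conflict⇒¬satisfiable : ∀ {f c} m → c ∈ f → ⟦ c ⟧ᶜ m ≡ F → ¬ Satisfiable f (reverse m)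
  conflict⇒¬satisfiable m c∈f eq (v , v⊩f , ag) =
    agrees-false-clause _ m ag eq (All.lookup v⊩f c∈f)

  -- A literal that makes a clause true under `v` is not `∼ l`, so overwriting the atom of `l`
  -- cannot spoil it.
  pure-⊩ᶠ : ∀ {v l} f → ¬ (∼ l OccursIn f) → v ⊩ᶠ f → assign v l ⊩ᶠ f
  pure-⊩ᶠ         []      _    []        = []
  pure-⊩ᶠ {v} {l} (c ∷ f) ∼l∉f (t ∷ ts) with find t
  ... | k , k∈c , v⊩k =
    lose k∈c (assign-preserves v l k (λ { refl → ∼l∉f (here k∈c) }) v⊩k)
    ∷ pure-⊩ᶠ f (∼l∉f ∘ there) ts

  -- As `l` is undefined, `∼ l` does not occur in `m`, and only `∼ l` could be spoilt by the update.
  assign-agrees : ∀ {v l} m → ⟦ l ⟧ˡ m ≡ U → Agrees v (reverse m) →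
                  Agrees (assign v l) (reverse m)
  assign-agrees {v} {l} m eq ag = All.tabulate λ {a} a∈ →
    assign-preserves v l (literal a)
      (λ a≡∼l → undefined⇒∉ l m eq
        (inj₂ (subst (_∈ map literal m) a≡∼l (∈-map⁺ literal (reverse⁻ a∈)))))
      (All.lookup ag a∈)

  noDecisions-reverse : ∀ n → NoDecisions n → NoDecisions (reverse n)
  noDecisions-reverse n nd l = nd l ∘ reverse⁻

  -- `fail` carries no formula, so the initial one is a parameter. Reversal turns appending on the
  -- right into consing.
  Invariant : Formula → State → Set
  Invariant f fail    = ¬ Satisfiable f []
  Invariant f (m ∥ g) = g ≡ f × Justified f (reverse m)

  reverse-∷ʳ-justified : ∀ {f} m a → Justified f (a ∷ reverse m) → Justified f (reverse (m ∷ʳ a))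
  reverse-∷ʳ-justified m a = subst (Justified _) (sym (reverse-++ m (a ∷ [])))

  reverse-middle : ∀ m (a : AnnotatedLiteral) n →
                   reverse (m ++ a ∷ n) ≡ reverse n ++ a ∷ reverse m
  reverse-middle m a n = trans (reverse-++ m (a ∷ n))
    (trans (cong (_++ reverse m) (unfold-reverse a n)) (++-assoc (reverse n) (a ∷ []) (reverse m)))

  step-invariant : ∀ {f s t} → s ⟹ t → Invariant f s → Invariant f t
  step-invariant (unitPropagate {m} {c = c} {l = l} c′∈f c′↭ eq _) (refl , j) =
    refl , reverse-∷ʳ-justified m _ (propagated sat j)
    where
    sat : Satisfiable _ (reverse m) → Satisfiable _ (l ᵖ ∷ reverse m)
    -- The true literal of the unit clause lies in `c`, which is impossible, or is `l` itself; `v`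
    -- is kept.
    sat (v , v⊩f , ag) with ++⁻ c (Any-resp-↭ c′↭ (All.lookup v⊩f c′∈f))
    ... | inj₁ t = ⊥-elim (agrees-false-clause c m ag eq t)
    ... | inj₂ t = v , v⊩f , singleton⁻ t ∷ ag
  step-invariant (decide {m} _ _) (refl , j) =
    refl , reverse-∷ʳ-justified m _ (decision j)
  step-invariant (failure {m} c∈f eq nd) (refl , j) sat =
    conflict⇒¬satisfiable m c∈f eq
      (subst (Satisfiable _) (++-identityʳ (reverse m))
        (satisfiable-++ (reverse m) (noDecisions-reverse m nd)
          (subst (Justified _) (sym (++-identityʳ (reverse m))) j) sat))
  step-invariant (backtrack {m} {l} {n} c∈f eq nd) (refl , j) =
    refl , reverse-∷ʳ-justified m _ (propagated sat (justified-tail (justified-++⁻ʳ (reverse n) j′)))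
    where
    j′ : Justified _ (reverse n ++ l ᵈ ∷ reverse m)
    j′ = subst (Justified _) (reverse-middle m (l ᵈ) n) j

    justified-tail : ∀ {f m} → Justified f (l ᵈ ∷ m) → Justified f m
    justified-tail = justified-++⁻ʳ (l ᵈ ∷ [])

    sat : Satisfiable _ (reverse m) → Satisfiable _ ((∼ l) ᵖ ∷ reverse m)
    -- If `v` satisfies `l` instead, it agrees with `m` followed by `l`, and the propagations of `n`
    -- lead to a valuation that agrees with the whole conflicting assignment.
    sat (v , v⊩f , ag) with ⊩-total v l
    ... | inj₂ t = v , v⊩f , t ∷ ag
    ... | inj₁ t = ⊥-elim (conflict⇒¬satisfiable (m ++ l ᵈ ∷ n) c∈f eq
      (subst (Satisfiable _) (sym (reverse-middle m (l ᵈ) n))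
        (satisfiable-++ (reverse n) (noDecisions-reverse n nd) j′ (v , v⊩f , t ∷ ag))))
  step-invariant (pure {m} {f} {l} _ ∼l∉f eq) (refl , j) =
    refl , reverse-∷ʳ-justified m _ (propagated sat j)
    where
    sat : Satisfiable f (reverse m) → Satisfiable f (l ᵖ ∷ reverse m)
    sat (v , v⊩f , ag) =
      -- Pure is the one rule that replaces the valuation, since `l` need not be entailed.
      assign v l , pure-⊩ᶠ f ∼l∉f v⊩f , assign-⊩ v l ∷ assign-agrees m eq ag

  derivation-invariant : ∀ {f s t} → s ⟹* t → Invariant f s → Invariant f t
  derivation-invariant ε        = λ inv → inv
  derivation-invariant (r ◅ rs) = derivation-invariant rs ∘ step-invariant r

  fail⇒unsatisfiable : ∀ f → [] ∥ f ⟹* fail → Unsatisfiable f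
  fail⇒unsatisfiable f d (m , m⊨f) =
    derivation-invariant {f} d (refl , []) (induced m , ⊨⇒⊩ᶠ f m m⊨f , [])

  -- Refutation completeness

  Defined : Literal → PartialAssignment → Set
  Defined l m = l ∈ map literal m ⊎ ∼ l ∈ map literal m

  defined-∷ʳ : ∀ {l} m a → Defined l m → Defined l (m ∷ʳ a)
  defined-∷ʳ m a rewrite map-++ literal m (a ∷ []) = Sum.map ∈-++⁺ˡ ∈-++⁺ˡ

  defined-last : ∀ m a → literal a ∈ map literal (m ∷ʳ a)
  defined-last m a = ∈-map⁺ literal (∈-++⁺ʳ m (here refl))

  -- With every literal defined, one that is not true is false, which rules out the value `U`.
  false-clause : ∀ c m → All (λ l → Defined l m) c → ⟦ c ⟧ᶜ m ≢ T → ⟦ c ⟧ᶜ m ≡ F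
  false-clause c m def c≢T
    with any? (λ l → ⟦ l ⟧ˡ m ≟ᵛ T) c | all? (λ l → ⟦ l ⟧ˡ m ≟ᵛ F) c
  ... | yes _   | _       = ⊥-elim (c≢T refl)
  ... | no _    | yes _   = refl
  ... | no ¬any | no ¬all = ⊥-elim (¬all (All.zipWith not-true (def , ¬Any⇒All¬ c ¬any)))
    where
    not-true : ∀ {l} → Defined l m × ⟦ l ⟧ˡ m ≢ T → ⟦ l ⟧ˡ m ≡ F
    not-true {l} (d , l≢T) with ⟦ l ⟧ˡ m in eq
    ... | T = ⊥-elim (l≢T refl)
    ... | F = refl
    ... | U = ⊥-elim (undefined⇒∉ l m eq d)

  Conflict : Formula → PartialAssignment → Set
  Conflict f m = ∃[ c ] c ∈ f × ⟦ c ⟧ᶜ m ≡ F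

  total⇒conflict : ∀ f m → Unsatisfiable f → All (All (λ l → Defined l m)) f → Conflict f m
  total⇒conflict f m unsat def with all? (λ c → ⟦ c ⟧ᶜ m ≟ᵛ T) f
  ... | yes ts = ⊥-elim (unsat (m , All⇒⊨ f m ts))
  ... | no ¬ts with find (¬All⇒Any¬ (λ c → ⟦ c ⟧ᶜ m ≟ᵛ T) f ¬ts)
  ...   | c , c∈f , c≢T = c , c∈f , false-clause c m (All.lookup def c∈f) c≢T

  -- Since `n` has no decisions, a decision that ends `m` is the latest one, so Backtrack flips it;
  -- with `m` empty, Fail applies.
  ReachesConflict : Formula → PartialAssignment → Set
  ReachesConflict f m =
    ∃[ n ] NoDecisions n × (m ∥ f ⟹* m ++ n ∥ f) × Conflict f (m ++ n)

  branch : ∀ {f l} m → l OccursIn f → ⟦ l ⟧ˡ m ≡ U →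
           ReachesConflict f (m ∷ʳ l ᵈ) → ReachesConflict f (m ∷ʳ (∼ l) ᵖ) → ReachesConflict f m
  branch {f} {l} m occ eq (n₁ , nd₁ , d₁ , (c , c∈f , false₁)) (n₂ , nd₂ , d₂ , conflict₂)
    -- Reassociation exposes the decision between `m` and `n₁`, the form that Backtrack expects.
    rewrite ++-assoc m (l ᵈ ∷ []) n₁ | ++-assoc m ((∼ l) ᵖ ∷ []) n₂ =
    -- The flipped literal is propagated, so the suffix stays free of decisions.
    (∼ l) ᵖ ∷ n₂
    , (λ { k (there k∈) → nd₂ k k∈ })
    , decide (inj₁ occ) eq ◅ d₁ ◅◅ backtrack c∈f false₁ nd₁ ◅ d₂
    , conflict₂

  cover-tail : ∀ {f l ls m} → Defined l m →
               (∀ {k} → k OccursIn f → k ∈ l ∷ ls ⊎ Defined k m) →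
               ∀ {k} → k OccursIn f → k ∈ ls ⊎ Defined k m
  cover-tail d cover occ with cover occ
  ... | inj₁ (here refl) = inj₂ d
  ... | inj₁ (there k∈)  = inj₁ k∈
  ... | inj₂ d′          = inj₂ d′

  -- ls lists the literals of f that may still be undefined in m.
  search : ∀ f → Unsatisfiable f → ∀ ls m → All (_OccursIn f) ls →
           (∀ {l} → l OccursIn f → l ∈ ls ⊎ Defined l m) → ReachesConflict f m
  -- Nothing is left to assign: `cover` makes every literal of `f` defined, so `m` itself is in
  -- conflict.
  search f unsat [] m _ cover =
    [] , (λ _ ()) , subst (λ k → m ∥ f ⟹* k ∥ f) (sym (++-identityʳ m)) ε
    , subst (Conflict f) (sym (++-identityʳ m)) (total⇒conflict f m unsat
        (All.tabulate λ c∈f → All.tabulate λ l∈c → case cover (lose c∈f l∈c) of λ { (inj₂ d) → d }))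
  search f unsat (l ∷ ls) m (occ ∷ occs) cover with ⟦ l ⟧ˡ m in eq
  ... | T = search f unsat ls m occs (cover-tail (inj₁ (true⇒∈ l m eq)) cover)
  ... | F = search f unsat ls m occs (cover-tail (inj₂ (false⇒∈ l m eq)) cover)
  -- Either sign of `l` makes it defined, so both branches recurse on `ls`.
  ... | U = branch m occ eq
    (search f unsat ls (m ∷ʳ l ᵈ) occs
      (cover-tail (inj₁ (defined-last m (l ᵈ))) (Sum.map₂ (defined-∷ʳ m (l ᵈ)) ∘ cover)))
    (search f unsat ls (m ∷ʳ (∼ l) ᵖ) occs
      (cover-tail (inj₂ (defined-last m ((∼ l) ᵖ))) (Sum.map₂ (defined-∷ʳ m ((∼ l) ᵖ)) ∘ cover)))

  unsatisfiable⇒fail : ∀ f → Unsatisfiable f → [] ∥ f ⟹* fail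
  unsatisfiable⇒fail f unsat
    with search f unsat (concat f) [] (All.tabulate (∈-concat⁻ f)) (inj₁ ∘ ∈-concat⁺)
  -- From the empty assignment, `n` is the entire assignment, so its lack of decisions permits Fail.
  ... | n , nd , d , (c , c∈f , c-false) = d ◅◅ failure c∈f c-false nd ◅ ε

theorem43 : {n : ℕ} {P : Set} (finite : P ↔ Fin n) →
    let open DPLL finite in
    (f : Formula) → ([] ∥ f ⟹* fail) ⇔ Unsatisfiable f
theorem43 finite f = mk⇔ (fail⇒unsatisfiable finite f) (unsatisfiable⇒fail finite f)
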